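{- Let $\mathcal{P}$ be a locally geometric poset and let $a$ be an atom of $\mathcal{P}$. Then $$\chi_{\mathcal{P}}(t)=t^{\epsilon(a)}\chi_{\mathcal{P}'}(t)-\chi_{\mathcal{P}''}(t),$$ where $\epsilon(a):=\operatorname{rk}(\mathcal{P})-\operatorname{rk}(\mathcal{P}')$.
   Context: All posets are finite, have a unique minimal element $\hat0$ and are ranked; $\operatorname{rk}(\mathcal{P})=\max_x\operatorname{rk}(x)$; $\chi_{\mathcal{P}}(t)=\sum_x\mu(\hat0,x)t^{\operatorname{rk}(\mathcal{P})-\operatorname{rk}(x)}$. $A(\mathcal{P})$ is the set of atoms. For $T\subseteq\mathcal{P}$, $\bigvee T$ is the set of minimal upper bounds of $T$. A lattice is geometric if $y$ covers $x$ iff there is an atom $a\not\le x$ with $y=x\vee a$; $\mathcal{P}$ is locally geometric if each $\mathcal{P}_{\le x}$ is a geometric lattice. For $B\subseteq A(\mathcal{P})$, $\mathcal{P}(B)$ is the subposet consisting of $\hat0$ and all elements of $\bigvee T$ for nonempty $T\subseteq B$. $\mathcal{P}':=\mathcal{P}(A(\mathcal{P})\setminus\{a\})$ and $\mathcal{P}'':=\mathcal{P}_{\ge a}=\{y:y\ge a\}$, with minimal element $a$ and rank function $\operatorname{rk}-1$; characteristic polynomials of $\mathcal{P}'$, $\mathcal{P}''$ are computed with their own ranks.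
   Formalization: The formal theorem adds the hypothesis rk(P) = rk(P'') + 1, automatic when all maximal elements have equal rank; without it the identity fails, e.g. for P = {0, a, b, c, b∨c} with a maximal. -}

module Defs where

open import Data.Empty using (⊥-elim)
open import Data.Fin.Base using (Fin)
open import Data.Fin.Induction using (spo-wellFounded)
open import Data.Integer as ℤ using (ℤ; 0ℤ; 1ℤ)
open import Data.Irrelevant using ([_])
open import Data.List.Base
  using (List; []; _∷_; _++_; map; filter; foldr; length; lookup;
         replicate)
open import Data.List.Extrema.Nat using (max)
open import Data.List.Membership.Propositional using (_∈_; lose)
open import Data.List.Membership.Propositional.Properties
  using (∈-filter⁺; ∈-filter⁻)
open import Data.List.Properties using (map-cong; map-∘)
open import Data.List.Relation.Binary.Subset.Propositional using (_⊆_)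
open import Data.List.Relation.Unary.All as All using (All)
open import Data.List.Relation.Unary.Any as Any using (Any; here; there)
open import Data.List.Relation.Unary.Any.Properties using (lookup-index; map⁺)
open import Data.List.Relation.Unary.Unique.Propositional using (Unique)
import Data.List.Relation.Unary.Unique.Propositional.Properties as Unique
open import Data.Nat as ℕ using (ℕ; zero; suc; _∸_)
open import Data.Product using (∃; ∃-syntax; _×_; _,_; proj₁; proj₂)
open import Data.Refinement using (Refinement; _,_; value)
open import Data.Refinement.Properties using (value-injective)
open import Data.Sum using (_⊎_; inj₁; inj₂)
open import Function.Base using (_∘_; _on_)
open import Function.Bundles using (_⇔_)
open import Induction.WellFounded
  using (WellFounded; WfRec; module All; module FixPoint; module Subrelation)
open import Level using (0ℓ)
open import Relation.Binary.Core using (Rel)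
import Relation.Binary.Construct.NonStrictToStrict as ToStrict
import Relation.Binary.Construct.On as On
open import Relation.Binary.Definitions using (Minimum)
open import Relation.Binary.Lattice.Structures using (IsLattice)
open import Relation.Binary.PropositionalEquality
  using (_≡_; _≢_; refl; sym; trans; cong; subst; subst₂)
open import Relation.Binary.PropositionalEquality.Properties
  using (isEquivalence)
open import Relation.Binary.Structures
  using (IsDecPartialOrder; IsStrictPartialOrder)
open import Relation.Nullary.Decidable
  using (Dec; yes; no; map′; recompute; ¬?; _×-dec_; _⊎-dec_; _→-dec_)
open import Relation.Nullary.Negation using (¬_)
open import Relation.Unary using (Pred; Decidable)

-- Coefficient lists, constant term first; trailing zeros are allowed, so
-- equality of polynomials is _≈_.

Poly : Set
Poly = List ℤ

coeff : Poly → ℕ → ℤ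
coeff []      _       = 0ℤ
coeff (c ∷ _) zero    = c
coeff (_ ∷ p) (suc k) = coeff p k

infix  4 _≈_
infixl 6 _+_ _-_
infixr 8 t^_·_

_≈_ : Rel Poly 0ℓ
p ≈ q = ∀ k → coeff p k ≡ coeff q k

_+_ : Poly → Poly → Poly
[]      + q       = q
(a ∷ p) + []      = a ∷ p
(a ∷ p) + (b ∷ q) = (a ℤ.+ b) ∷ (p + q)

_-_ : Poly → Poly → Poly
p - q = p + map ℤ.-_ q

t^_·_ : ℕ → Poly → Poly
t^ n · p = replicate n 0ℤ ++ p

module _ {A : Set} {Q : Pred A 0ℓ} (Q? : Decidable Q) where

  select : List A → List (∃ Q)
  select []       = []
  select (x ∷ xs) with Q? x
  ... | yes q = (x , q) ∷ select xs
  ... | no  _ = select xs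

  map-select : ∀ xs → map proj₁ (select xs) ≡ filter Q? xs
  map-select []       = refl
  map-select (x ∷ xs) with Q? x
  ... | yes _ = cong (x ∷_) (map-select xs)
  ... | no  _ = map-select xs

  select-complete : ∀ {x xs} → Q x → x ∈ xs → Any ((x ≡_) ∘ proj₁) (select xs)
  select-complete {x} q (here refl) with Q? x
  ... | yes _ = here refl
  ... | no ¬q = ⊥-elim (¬q q)
  select-complete {xs = y ∷ _} q (there x∈xs) with Q? y
  ... | yes _ = there (select-complete q x∈xs)
  ... | no  _ = select-complete q x∈xs

-- In a finite poset, a unique minimal element is the same as a minimum.

record FinPoset : Set₁ where
  infix 4 _≤_ _<_ _⋖_
  field
    Carrier           : Set
    _≤_               : Rel Carrier 0ℓ
    isDecPartialOrder : IsDecPartialOrder _≡_ _≤_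
    0̂                 : Carrier
    minimum           : Minimum _≤_ 0̂
    elements          : List Carrier
    complete          : ∀ x → x ∈ elements
    unique            : Unique elements

  open IsDecPartialOrder isDecPartialOrder public
    using (isPartialOrder; _≟_; _≤?_; antisym)
    renaming (refl to ≤-refl; reflexive to ≤-reflexive; trans to ≤-trans)

  _<_ : Rel Carrier 0ℓ
  _<_ = ToStrict._<_ _≡_ _≤_

  <-isStrictPartialOrder : IsStrictPartialOrder _≡_ _<_
  <-isStrictPartialOrder = ToStrict.<-isStrictPartialOrder _≡_ _≤_ isPartialOrder

  _<?_ : ∀ x y → Dec (x < y)
  x <? y = (x ≤? y) ×-dec ¬? (x ≟ y)

  all? : {Q : Pred Carrier 0ℓ} → Decidable Q → Dec (∀ x → Q x)
  all? Q? = map′ (λ qs x → All.lookup qs (complete x)) (λ q → All.universal q _)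
                 (All.all? Q? elements)

  any? : {Q : Pred Carrier 0ℓ} → Decidable Q → Dec (∃ Q)
  any? Q? = map′ Any.satisfied (λ (x , q) → lose (complete x) q)
                 (Any.any? Q? elements)

  <-wellFounded : WellFounded _<_
  <-wellFounded = Subrelation.wellFounded toIndex
    (On.wellFounded index (spo-wellFounded
      (On.isStrictPartialOrder (lookup elements) <-isStrictPartialOrder)))
    where
    index : Carrier → Fin (length elements)
    index x = Any.index (complete x)

    toIndex : ∀ {x y} → x < y →
              lookup elements (index x) < lookup elements (index y)
    toIndex {x} {y} = subst₂ _<_ (lookup-index (complete x))
                                 (lookup-index (complete y))

  _⋖_ : Rel Carrier 0ℓ
  x ⋖ y = x < y × ¬ (∃[ z ] x < z × z < y)

  Atom : Pred Carrier 0ℓ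
  Atom a = 0̂ ⋖ a

  atom? : Decidable Atom
  atom? a = (0̂ <? a) ×-dec ¬? (any? λ z → (0̂ <? z) ×-dec (z <? a))

  -- Finite subsets are given by lists, in which repetitions are harmless.

  atoms : List Carrier
  atoms = filter atom? elements

  UpperBound : List Carrier → Pred Carrier 0ℓ
  UpperBound T u = All (_≤ u) T

  ⋁ : List Carrier → Pred Carrier 0ℓ
  ⋁ T x = UpperBound T x × (∀ u → UpperBound T u → u ≤ x → u ≡ x)

  ⋁? : ∀ T → Decidable (⋁ T)
  ⋁? T x = All.all? (_≤? x) T ×-dec
           all? λ u → All.all? (_≤? u) T →-dec (u ≤? x →-dec (u ≟ x))

  -- The length of a longest chain from 0̂ to x.

  rk-step : ∀ x → WfRec _<_ (λ _ → ℕ) x → ℕ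
  rk-step x rec =
    max 0 (map (λ (y , y<x) → suc (rec {y} y<x)) (select (_<? x) elements))

  rk : Carrier → ℕ
  rk = All.wfRec <-wellFounded 0ℓ (λ _ → ℕ) rk-step

  rank : ℕ
  rank = max 0 (map rk elements)

  -- The Möbius function, by recursion on its second argument.  When
  -- x ≰ y the sum is empty, so that μ x y = 0.

  sum : List ℤ → ℤ
  sum = foldr ℤ._+_ 0ℤ

  [_,_⟩? : ∀ x y → Decidable (λ z → x ≤ z × z < y)
  [ x , y ⟩? z = (x ≤? z) ×-dec (z <? y)

  μ-step : ∀ x y → WfRec _<_ (λ _ → ℤ) y → ℤ
  μ-step x y rec with x ≟ y
  ... | yes _ = 1ℤ
  ... | no  _ =
    ℤ.- sum (map (λ (z , _ , z<y) → rec {z} z<y) (select [ x , y ⟩? elements))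

  μ : Carrier → Carrier → ℤ
  μ x = All.wfRec <-wellFounded 0ℓ (λ _ → ℤ) (μ-step x)

  χ : Poly
  χ = foldr _+_ [] (map (λ x → t^ (rank ∸ rk x) · (μ 0̂ x ∷ [])) elements)

  rk-unfold : ∀ x → rk x ≡ max 0 (map (suc ∘ rk) (filter (_<? x) elements))
  rk-unfold x = trans
    (FixPoint.unfold-wfRec <-wellFounded (λ _ → ℕ) rk-step
      (λ y eq → cong (max 0) (map-cong (λ (_ , p) → cong suc (eq p))
                                       (select (_<? y) elements))))
    (cong (max 0) (trans (map-∘ (select (_<? x) elements))
                         (cong (map (suc ∘ rk)) (map-select (_<? x) elements))))

  μ-step-ext : ∀ x y {f g : WfRec _<_ (λ _ → ℤ) y} →
               (∀ {z} z<y → f {z} z<y ≡ g z<y) → μ-step x y f ≡ μ-step x y g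
  μ-step-ext x y eq with x ≟ y
  ... | yes _ = refl
  ... | no  _ = cong (ℤ.-_ ∘ sum) (map-cong (λ (_ , _ , p) → eq p)
                                            (select [ x , y ⟩? elements))

  μ-unfold : ∀ x y → μ x y ≡ μ-step x y (λ {z} _ → μ x z)
  μ-unfold x y =
    FixPoint.unfold-wfRec <-wellFounded (λ _ → ℤ) (μ-step x) (μ-step-ext x)

  μ-refl : ∀ x → μ x x ≡ 1ℤ
  μ-refl x with x ≟ x | μ-unfold x x
  ... | yes _  | eq = eq
  ... | no x≢x | _  = ⊥-elim (x≢x refl)

  μ-rec : ∀ {x y} → x ≢ y →
          μ x y ≡ ℤ.- sum (map (μ x) (filter [ x , y ⟩? elements))
  μ-rec {x} {y} x≢y with x ≟ y | μ-unfold x y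
  ... | yes x≡y | _  = ⊥-elim (x≢y x≡y)
  ... | no  _   | eq = trans eq (cong (ℤ.-_ ∘ sum)
    (trans (map-∘ (select [ x , y ⟩? elements))
           (cong (map (μ x)) (map-select [ x , y ⟩? elements))))

open FinPoset using (Carrier)

module _ (P : FinPoset) where
  open FinPoset P hiding (Carrier)

  subposet : {Q : Pred (Carrier P) 0ℓ} → Decidable Q →
             ∀ b → Q b → (∀ x → Q x → b ≤ x) → FinPoset
  subposet {Q} Q? b qb b-min = record
    { Carrier           = Refinement (Carrier P) Q
    ; _≤_               = _≤_ on value
    ; isDecPartialOrder = record
        { isPartialOrder = record
            { isPreorder = record
                { isEquivalence = isEquivalence
                ; reflexive     = λ { refl → ≤-refl }
                ; trans         = ≤-trans
                }
            ; antisym    = λ p q → value-injective (antisym p q)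
            }
        ; _≟_  = λ x y → map′ value-injective (cong value) (value x ≟ value y)
        ; _≤?_ = λ x y → value x ≤? value y
        }
    ; 0̂                 = b , [ qb ]
    ; minimum           = λ (x , [ q ]) → recompute (b ≤? x) (b-min x q)
    ; elements          = map irr (select Q? elements)
    ; complete          = λ (x , [ q ]) → complete′ x q
    ; unique            = Unique.map⁻ (unique′ (Unique.filter⁺ Q? unique))
    }
    where
    irr : ∃ Q → Refinement (Carrier P) Q
    irr (x , q) = x , [ q ]

    complete′ : ∀ x .(q : Q x) → (x , [ q ]) ∈ map irr (select Q? elements)
    complete′ x q = map⁺ (Any.map (λ { refl → refl })
      (select-complete Q? (recompute (Q? x) q) (complete x)))

    unique′ : Unique (filter Q? elements) →
            Unique (map value (map irr (select Q? elements)))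
    unique′ = subst Unique
      (trans (sym (map-select Q? elements)) (map-∘ (select Q? elements)))

  below : Carrier P → FinPoset
  below x = subposet (_≤? x) 0̂ (minimum x) (λ y _ → minimum y)

  above : Carrier P → FinPoset
  above a = subposet (a ≤?_) a ≤-refl (λ _ a≤x → a≤x)

  -- This is the underlying set of P(B); generated B is P(B) itself, and
  -- deletion a is P(A(P) ∖ {a}).

  Generated : List (Carrier P) → Pred (Carrier P) 0ℓ
  Generated B x = x ≡ 0̂ ⊎ (∃[ T ] T ≢ [] × T ⊆ B × ⋁ T x)

  -- If x is a minimal upper bound of some T ⊆ B then it is one of
  -- { b ∈ B ∣ b ≤ x }, so only this T has to be tested.

  generated? : ∀ B → Decidable (Generated B)
  generated? B x = (x ≟ 0̂) ⊎-dec
    map′ (λ (ne , x∈⋁) → B≤x , ne , proj₁ ∘ ∈-filter⁻ (_≤? x) , x∈⋁)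
         canonical
         (nonempty? B≤x ×-dec ⋁? B≤x x)
    where
    B≤x = filter (_≤? x) B

    nonempty? : Decidable (_≢ [])
    nonempty? []      = no λ ne → ne refl
    nonempty? (_ ∷ _) = yes λ ()

    canonical : (∃[ T ] T ≢ [] × T ⊆ B × ⋁ T x) → B≤x ≢ [] × ⋁ B≤x x
    canonical (T , ne , T⊆B , ub , min) =
      B≤x≢[] T ne T⊆B≤x ,
      All.tabulate (proj₂ ∘ ∈-filter⁻ (_≤? x) {xs = B}) ,
      λ u ub′ → min u (All.tabulate (All.lookup ub′ ∘ T⊆B≤x))
      where
      T⊆B≤x : T ⊆ B≤x
      T⊆B≤x t∈T = ∈-filter⁺ (_≤? x) (T⊆B t∈T) (All.lookup ub t∈T)

      B≤x≢[] : ∀ T → T ≢ [] → T ⊆ B≤x → B≤x ≢ []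
      B≤x≢[] []      ne _   _  = ne refl
      B≤x≢[] (t ∷ _) _  sub eq with B≤x | sub (here refl)
      B≤x≢[] (t ∷ _) _  sub refl | .[] | ()

  generated : List (Carrier P) → FinPoset
  generated B = subposet (generated? B) 0̂ (inj₁ refl) (λ x _ → minimum x)

  deletion : Carrier P → FinPoset
  deletion a = generated (filter (λ b → ¬? (b ≟ a)) atoms)

  contraction : Carrier P → FinPoset
  contraction = above

-- Equivalently, for each x all maximal chains from 0̂ to x have the same
-- length.  Maximal elements may have different ranks.

Ranked : FinPoset → Set
Ranked P = ∀ {x y} → x ⋖ y → rk y ≡ suc (rk x)
  where open FinPoset P

record IsGeometricLattice (L : FinPoset) : Set where
  open FinPoset L hiding (Carrier)
  field
    _∨_       : Carrier L → Carrier L → Carrier L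
    _∧_       : Carrier L → Carrier L → Carrier L
    isLattice : IsLattice _≡_ _≤_ _∨_ _∧_
    geometric : ∀ x y → x ⋖ y ⇔ (∃[ a ] Atom a × ¬ (a ≤ x) × y ≡ x ∨ a)

LocallyGeometric : FinPoset → Set
LocallyGeometric P = ∀ x → IsGeometricLattice (below P x)

-- Write μ′ and μ″ for the Möbius functions μ(0̂, ·) of P′ and μ(a, ·) of P″,
-- extended by zero to P.  Then μ(0̂, x) = μ′(x) − μ″(x) for all x, since both
-- sides have the same sums over the intervals [0̂, x]: P′ has a greatest element
-- below x, which is 0̂ exactly when x is 0̂ or a, so the sum of μ′ is 1 in these
-- two cases and 0 otherwise, while the sum of μ″ is 1 only for x = a.  As P′ and
-- P″ inherit their rank functions from P (up to a shift by one in P″), the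
-- identity of characteristic polynomials follows coefficient by coefficient.

module Submission where

open import Defs
open import Data.Nat using (suc; _∸_)
open import Relation.Binary.PropositionalEquality using (_≡_)
open FinPoset using (Carrier; Atom; rank; χ)

open import Algebra.Properties.CommutativeSemigroup using (interchange)
open import Algebra.Bundles using (module AbelianGroup)
open import Algebra.Properties.Group using (∙-cancelˡ)
open import Data.Empty using (⊥-elim)
open import Data.Integer as ℤ using (ℤ; 0ℤ; 1ℤ)
import Data.Integer.Properties as ℤ
open import Data.Irrelevant using ([_])
open import Data.List.Base using (List; []; _∷_; map; filter; foldr)
open import Data.List.Extrema.Nat using (max; max≤v⁺; v≤max⁺)
open import Data.List.Membership.Propositional using (_∈_; find)
open import Data.List.Membership.Propositional.Properties
  using (∈-filter⁺; ∈-filter⁻)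
open import Data.List.Relation.Binary.Subset.Propositional using (_⊆_)
open import Data.List.Relation.Unary.All as All using (All; []; _∷_)
import Data.List.Relation.Unary.All.Properties as All
import Data.List.Relation.Unary.AllPairs as AllPairs
import Data.List.Relation.Unary.Any as Any
open import Data.List.Relation.Unary.Any using (here; there)
import Data.List.Relation.Unary.Any.Properties as Any
open import Data.List.Relation.Unary.Unique.Propositional using (Unique)
open import Data.Nat as ℕ using (ℕ; zero; z≤n)
import Data.Nat.Properties as ℕ
open import Data.Product using (∃; ∃-syntax; _×_; _,_; proj₁; proj₂)
open import Data.Refinement using (Refinement; _,_; value)
open import Data.Refinement.Properties using (value-injective)
open import Data.Sum using (_⊎_; inj₁; inj₂)
open import Function.Base using (_∘_)
open import Function.Bundles using (module Equivalence)
import Induction.WellFounded as WF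
open import Level using (0ℓ)
open import Relation.Binary.Lattice.Structures using (IsLattice)
open import Relation.Binary.PropositionalEquality
  using (_≢_; refl; sym; trans; cong; cong₂; subst; module ≡-Reasoning)
open import Relation.Nullary.Decidable
  using (Dec; yes; no; recompute; ¬?; _×-dec_)
open import Relation.Nullary.Negation using (¬_)
open import Relation.Unary using (Pred; Decidable)

-- Finite sums of integers with decidable conditions

private
  variable
    A B : Set

infix 5 _when_

-- Takes the decision itself, so that decisions of equivalent conditions on different types can be
-- exchanged by `when-⇔`.
_when_ : ℤ → Dec A → ℤ
v when yes _ = v
v when no _  = 0ℤ

when-⇔ : ∀ v (d : Dec A) (e : Dec B) → (A → B) → (B → A) → v when d ≡ v when e
when-⇔ v (yes _) (yes _) f g = refl
when-⇔ v (yes p) (no ¬q) f g = ⊥-elim (¬q (f p))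
when-⇔ v (no ¬p) (yes q) f g = ⊥-elim (¬p (g q))
when-⇔ v (no _)  (no _)  f g = refl

when-yes : ∀ v (d : Dec A) → A → v when d ≡ v
when-yes v (yes _) p = refl
when-yes v (no ¬p) p = ⊥-elim (¬p p)

when-no : ∀ v (d : Dec A) → ¬ A → v when d ≡ 0ℤ
when-no v (yes p) ¬p = ⊥-elim (¬p p)
when-no v (no _)  ¬p = refl

when-+ : ∀ u v (d : Dec A) → (u ℤ.+ v) when d ≡ (u when d) ℤ.+ (v when d)
when-+ u v (yes _) = refl
when-+ u v (no _)  = refl

when-neg : ∀ v (d : Dec A) → (ℤ.- v) when d ≡ ℤ.- (v when d)
when-neg v (yes _) = refl
when-neg v (no _)  = refl

∑ : List A → (A → ℤ) → ℤ
∑ xs f = foldr ℤ._+_ 0ℤ (map f xs)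

∑-cong : ∀ (xs : List A) {f g : A → ℤ} → (∀ x → f x ≡ g x) → ∑ xs f ≡ ∑ xs g
∑-cong []       eq = refl
∑-cong (x ∷ xs) eq = cong₂ ℤ._+_ (eq x) (∑-cong xs eq)

∑-zero : ∀ (xs : List A) {f : A → ℤ} → (∀ x → f x ≡ 0ℤ) → ∑ xs f ≡ 0ℤ
∑-zero []       eq = refl
∑-zero (x ∷ xs) eq = cong₂ ℤ._+_ (eq x) (∑-zero xs eq)

∑-+ : ∀ (xs : List A) (f g : A → ℤ) →
      ∑ xs (λ x → f x ℤ.+ g x) ≡ ∑ xs f ℤ.+ ∑ xs g
∑-+ []       f g = refl
∑-+ (x ∷ xs) f g = trans (cong (λ s → f x ℤ.+ g x ℤ.+ s) (∑-+ xs f g))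
  (interchange ℤ.+-commutativeSemigroup (f x) (g x) (∑ xs f) (∑ xs g))

∑-neg : ∀ (xs : List A) (f : A → ℤ) → ∑ xs (λ x → ℤ.- f x) ≡ ℤ.- ∑ xs f
∑-neg []       f = refl
∑-neg (x ∷ xs) f = trans (cong (λ s → ℤ.- f x ℤ.+ s) (∑-neg xs f))
                         (sym (ℤ.neg-distrib-+ (f x) (∑ xs f)))

∑-filter : ∀ {Q : Pred A 0ℓ} (Q? : Decidable Q) xs (f : A → ℤ) →
           ∑ (filter Q? xs) f ≡ ∑ xs (λ x → f x when Q? x)
∑-filter Q? []       f = refl
∑-filter Q? (x ∷ xs) f with Q? x
... | yes _ = cong (λ s → f x ℤ.+ s) (∑-filter Q? xs f)
... | no _  = trans (∑-filter Q? xs f) (sym (ℤ.+-identityˡ _))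

∑-when-minus : ∀ {Q : Pred A 0ℓ} (Q? : Decidable Q) (xs : List A) (f g : A → ℤ) →
               ∑ xs (λ x → (f x ℤ.- g x) when Q? x) ≡
               ∑ xs (λ x → f x when Q? x) ℤ.- ∑ xs (λ x → g x when Q? x)
∑-when-minus Q? xs f g = begin
  ∑ xs (λ x → (f x ℤ.- g x) when Q? x)
    ≡⟨ ∑-cong xs (λ x → trans (when-+ (f x) (ℤ.- g x) (Q? x))
         (cong (λ v → (f x when Q? x) ℤ.+ v) (when-neg (g x) (Q? x)))) ⟩
  ∑ xs (λ x → (f x when Q? x) ℤ.+ ℤ.- (g x when Q? x))
    ≡⟨ ∑-+ xs _ _ ⟩
  ∑ xs (λ x → f x when Q? x) ℤ.+ ∑ xs (λ x → ℤ.- (g x when Q? x))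
    ≡⟨ cong (λ s → ∑ xs (λ x → f x when Q? x) ℤ.+ s) (∑-neg xs _) ⟩
  ∑ xs (λ x → f x when Q? x) ℤ.- ∑ xs (λ x → g x when Q? x) ∎
  where open ≡-Reasoning

∑-absent : ∀ (_≟_ : ∀ (x y : A) → Dec (x ≡ y)) (f : A → ℤ) {x xs} →
           All (x ≢_) xs → ∑ xs (λ z → f z when (z ≟ x)) ≡ 0ℤ
∑-absent _≟_ f         []            = refl
∑-absent _≟_ f {x} {y ∷ _} (x≢y ∷ x∉ys) =
  cong₂ ℤ._+_ (when-no (f y) (y ≟ x) (x≢y ∘ sym)) (∑-absent _≟_ f x∉ys)

∑-single : ∀ (_≟_ : ∀ (x y : A) → Dec (x ≡ y)) (f : A → ℤ) {x xs} →
           Unique xs → x ∈ xs → ∑ xs (λ z → f z when (z ≟ x)) ≡ f x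
∑-single _≟_ f {x} (x∉xs AllPairs.∷ _) (here refl) =
  trans (cong₂ ℤ._+_ (when-yes (f x) (x ≟ x) refl) (∑-absent _≟_ f x∉xs))
        (ℤ.+-identityʳ (f x))
∑-single _≟_ f {x} {y ∷ _} (y∉xs AllPairs.∷ uniq) (there x∈xs) =
  trans (cong₂ ℤ._+_ (when-no (f y) (y ≟ x) (All.lookup y∉xs x∈xs))
                     (∑-single _≟_ f uniq x∈xs))
        (ℤ.+-identityˡ (f x))

-- Extension by zero from a subset

module _ {Q : Pred A 0ℓ} (Q? : Decidable Q) where

  extend : (Refinement A Q → ℤ) → A → ℤ
  extend g x with Q? x
  ... | yes q = g (x , [ q ])
  ... | no _  = 0ℤ

  extend-when : ∀ {R : Pred A 0ℓ} (R? : Decidable R) g x →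
                extend g x when R? x ≡ extend (λ y → g y when R? (value y)) x
  extend-when R? g x with Q? x
  ... | yes _ = refl
  ... | no _ with R? x
  ... | yes _ = refl
  ... | no _  = refl

  -- The map h stands for the function irr in the where block of subposet, which
  -- is not in scope; it is determined by unification at each use.
  ∑-extend : ∀ {h : ∃ Q → Refinement A Q} →
             (∀ x q → h (x , q) ≡ (x , [ q ])) → ∀ g xs →
             ∑ (map h (select Q? xs)) g ≡ ∑ xs (extend g)
  ∑-extend h≡ g []       = refl
  ∑-extend h≡ g (x ∷ xs) with Q? x
  ... | yes q = cong₂ ℤ._+_ (cong g (h≡ x q)) (∑-extend h≡ g xs)
  ... | no _  = trans (∑-extend h≡ g xs) (sym (ℤ.+-identityˡ _))

-- Coefficients of polynomials

coeff-+ : ∀ p q k → coeff (p + q) k ≡ coeff p k ℤ.+ coeff q k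
coeff-+ []      q       k       = sym (ℤ.+-identityˡ _)
coeff-+ (a ∷ p) []      k       = sym (ℤ.+-identityʳ _)
coeff-+ (a ∷ p) (b ∷ q) zero    = refl
coeff-+ (a ∷ p) (b ∷ q) (suc k) = coeff-+ p q k

coeff-neg : ∀ p k → coeff (map ℤ.-_ p) k ≡ ℤ.- coeff p k
coeff-neg []      k       = refl
coeff-neg (a ∷ p) zero    = refl
coeff-neg (a ∷ p) (suc k) = coeff-neg p k

coeff-- : ∀ p q k → coeff (p - q) k ≡ coeff p k ℤ.- coeff q k
coeff-- p q k = trans (coeff-+ p (map ℤ.-_ q) k)
                      (cong (λ c → coeff p k ℤ.+ c) (coeff-neg q k))

coeff-monomial : ∀ n c k → coeff (t^ n · (c ∷ [])) k ≡ c when (n ℕ.≟ k)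
coeff-monomial zero    c zero    = refl
coeff-monomial zero    c (suc k) = refl
coeff-monomial (suc n) c zero    = refl
coeff-monomial (suc n) c (suc k) = trans (coeff-monomial n c k)
  (when-⇔ c (n ℕ.≟ k) (suc n ℕ.≟ suc k) (cong suc) ℕ.suc-injective)

-- Reads a coefficient of a characteristic polynomial as a sum of Möbius values over the elements
-- with a fixed exponent. For `n = 0` the shift disappears by computation, so the unshifted case is
-- included.
coeff-shifted-∑ : ∀ n (xs : List A) (e : A → ℕ) (c : A → ℤ) k →
  coeff (t^ n · foldr _+_ [] (map (λ x → t^ e x · (c x ∷ [])) xs)) k
    ≡ ∑ xs (λ x → c x when (n ℕ.+ e x ℕ.≟ k))
coeff-shifted-∑ zero    []       e c k = refl
coeff-shifted-∑ zero    (x ∷ xs) e c k =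
  trans (coeff-+ (t^ e x · (c x ∷ [])) _ k)
        (cong₂ ℤ._+_ (coeff-monomial (e x) (c x) k) (coeff-shifted-∑ zero xs e c k))
coeff-shifted-∑ (suc n) xs       e c zero    = sym (∑-zero xs (λ _ → refl))
coeff-shifted-∑ (suc n) xs       e c (suc k) = trans (coeff-shifted-∑ n xs e c k)
  (∑-cong xs λ x → when-⇔ (c x) (n ℕ.+ e x ℕ.≟ k) (suc n ℕ.+ e x ℕ.≟ suc k)
                          (cong suc) ℕ.suc-injective)

-- Maxima over lists

max-map-least : ∀ (f : A → ℕ) xs {n} → (∀ {x} → x ∈ xs → f x ℕ.≤ n) →
                max 0 (map f xs) ℕ.≤ n
max-map-least f xs f≤n = max≤v⁺ z≤n (All.map⁺ (All.tabulate f≤n))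

max-map-upper : ∀ (f : A → ℕ) {xs x} → x ∈ xs → f x ℕ.≤ max 0 (map f xs)
max-map-upper f {xs} x∈xs = v≤max⁺ 0 (map f xs)
  (inj₂ (Any.map⁺ (Any.map (λ { refl → ℕ.≤-refl }) x∈xs)))

-- Covers, ranks and Möbius inversion in a finite poset

module FinPosetProperties (P : FinPoset) where
  open FinPoset P hiding (Carrier; Atom; rank; χ)

  private
    C : Set
    C = Carrier P

  <-irrefl : ∀ {x y} → x < y → ¬ (y ≤ x)
  <-irrefl (x≤y , x≢y) y≤x = x≢y (antisym x≤y y≤x)

  module <-Ind = WF.All <-wellFounded 0ℓ

  -- One pass over `elements`, starting from `y`: an element of `Q` above the current candidate
  -- replaces it. The candidate only moves up, so no element passed earlier can later exceed it.
  maximal : {Q : Pred C 0ℓ} → Decidable Q → ∀ {y} → Q y →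
            ∃[ m ] Q m × y ≤ m × (∀ {z} → Q z → m ≤ z → z ≡ m)
  maximal {Q} Q? {y} qy =
    let m , qm , y≤m , max = search elements
    in  m , qm , y≤m , λ {z} → max (complete z)
    where
    search : ∀ xs → ∃[ m ] Q m × y ≤ m × (∀ {z} → z ∈ xs → Q z → m ≤ z → z ≡ m)
    search [] = y , qy , ≤-refl , λ ()
    search (x ∷ xs) with m , qm , y≤m , max ← search xs | Q? x ×-dec m ≤? x
    ... | yes (qx , m≤x) = x , qx , ≤-trans y≤m m≤x , λ where
      (here refl) _ _ → refl
      (there z∈xs) qz x≤z → antisym
        (≤-trans (≤-reflexive (max z∈xs qz (≤-trans m≤x x≤z))) m≤x) x≤z
    ... | no ¬q = m , qm , y≤m , λ where
      (here refl) qx m≤x → ⊥-elim (¬q (qx , m≤x))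
      (there z∈xs) qz m≤z → max z∈xs qz m≤z

  -- Nothing lies strictly between `y` and a maximal element of the half-open interval from `x` to
  -- `y`.
  cocover : ∀ {x y} → x < y → ∃[ z ] x ≤ z × z ⋖ y
  cocover {x} {y} x<y with
    m , (x≤m , m<y) , _ , max ← maximal (λ z → (x ≤? z) ×-dec (z <? y)) (≤-refl , x<y)
    = m , x≤m , m<y , λ (z , m<z , z<y) →
        proj₂ m<z (sym (max (≤-trans x≤m (proj₁ m<z) , z<y) (proj₁ m<z)))

  ≤-atom : ∀ {a x} → Atom P a → x ≤ a → x ≡ 0̂ ⊎ x ≡ a
  ≤-atom {a} {x} (_ , none) x≤a with 0̂ ≟ x | x ≟ a
  ... | yes 0≡x | _       = inj₁ (sym 0≡x)
  ... | _       | yes x≡a = inj₂ x≡a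
  ... | no 0≢x  | no x≢a  =
    ⊥-elim (none (x , (minimum x , 0≢x) , (x≤a , x≢a)))

  rk-mono : ∀ {x y} → x < y → suc (rk x) ℕ.≤ rk y
  rk-mono {x} {y} x<y = subst (suc (rk x) ℕ.≤_) (sym (rk-unfold y))
    (max-map-upper (suc ∘ rk) (∈-filter⁺ (_<? y) (complete x) x<y))

  -- Together with `rk-mono` this characterises `rk`, so that later arguments need not unfold it.
  rk-least : ∀ {x n} → (∀ {y} → y < x → suc (rk y) ℕ.≤ n) → rk x ℕ.≤ n
  rk-least {x} {n} bound = subst (ℕ._≤ n) (sym (rk-unfold x))
    (max-map-least (suc ∘ rk) (filter (_<? x) elements)
                   (bound ∘ proj₂ ∘ ∈-filter⁻ (_<? x) {xs = elements}))

  rk-0̂ : rk 0̂ ≡ 0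
  rk-0̂ = ℕ.n≤0⇒n≡0 (rk-least λ y<0 → ⊥-elim (<-irrefl y<0 (minimum _)))

  rk≤rank : ∀ x → rk x ℕ.≤ rank P
  rk≤rank x = max-map-upper rk (complete x)

  rank-least : ∀ {n} → (∀ x → rk x ℕ.≤ n) → rank P ℕ.≤ n
  rank-least bound = max-map-least rk elements λ {x} _ → bound x

  ∑≤ ∑< : (C → ℤ) → C → ℤ
  ∑≤ f x = ∑ elements (λ z → f z when (z ≤? x))
  ∑< f x = ∑ elements (λ z → f z when (z <? x))

  ∑≤-split : ∀ f x → ∑≤ f x ≡ ∑< f x ℤ.+ f x
  ∑≤-split f x = begin
    ∑≤ f x
      ≡⟨ ∑-cong elements split ⟩
    ∑ elements (λ z → (f z when (z <? x)) ℤ.+ (f z when (z ≟ x)))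
      ≡⟨ ∑-+ elements _ _ ⟩
    ∑< f x ℤ.+ ∑ elements (λ z → f z when (z ≟ x))
      ≡⟨ cong (λ s → ∑< f x ℤ.+ s) (∑-single _≟_ f unique (complete x)) ⟩
    ∑< f x ℤ.+ f x ∎
    where
    open ≡-Reasoning
    split : ∀ z → f z when (z ≤? x) ≡ (f z when (z <? x)) ℤ.+ (f z when (z ≟ x))
    split z with z ≟ x
    -- The split on `z ≟ x` also evaluates part of `z <? x`, hence the products with an explicit
    -- `no` here and `yes` below.
    ... | yes refl = trans (when-yes (f z) (z ≤? z) ≤-refl)
      (sym (trans (cong (ℤ._+ f z) (when-no (f z) (z ≤? z ×-dec no λ z≢z → z≢z refl)
                                            (λ (_ , z≢z) → z≢z refl)))
                  (ℤ.+-identityˡ (f z))))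
    ... | no z≢x = trans
      (when-⇔ (f z) (z ≤? x) (z ≤? x ×-dec yes z≢x) (λ z≤x → z≤x , z≢x) proj₁)
      (sym (ℤ.+-identityʳ _))

  -- The recursion for `μ`, rearranged: as `0̂` is the minimum, its interval sum runs over all
  -- elements strictly below `x`.
  ∑≤-μ : ∀ x → ∑≤ (μ 0̂) x ≡ 1ℤ when (0̂ ≟ x)
  ∑≤-μ x = trans (∑≤-split (μ 0̂) x) (rest (0̂ ≟ x))
    where
    rest : (d : Dec (0̂ ≡ x)) → ∑< (μ 0̂) x ℤ.+ μ 0̂ x ≡ 1ℤ when d
    rest (yes refl) = cong₂ ℤ._+_
      (∑-zero elements λ z → when-no (μ 0̂ z) (z <? 0̂) λ z<0 → <-irrefl z<0 (minimum z))
      (μ-refl 0̂)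
    rest (no 0≢x) = trans (cong (λ m → ∑< (μ 0̂) x ℤ.+ m) (begin
      μ 0̂ x
        ≡⟨ μ-rec 0≢x ⟩
      ℤ.- ∑ (filter [ 0̂ , x ⟩? elements) (μ 0̂)
        ≡⟨ cong ℤ.-_ (∑-filter [ 0̂ , x ⟩? elements (μ 0̂)) ⟩
      ℤ.- ∑ elements (λ z → μ 0̂ z when [ 0̂ , x ⟩? z)
        ≡⟨ cong ℤ.-_ (∑-cong elements λ z →
             when-⇔ (μ 0̂ z) ([ 0̂ , x ⟩? z) (z <? x) proj₂ (minimum z ,_)) ⟩
      ℤ.- ∑< (μ 0̂) x ∎)) (ℤ.+-inverseʳ (∑< (μ 0̂) x))
      where open ≡-Reasoning

  -- Uniqueness in Möbius inversion: by well-founded induction the terms strictly below `x` agree,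
  -- and cancelling them leaves the term at `x`.
  ∑≤-injective : ∀ {f g} → (∀ x → ∑≤ f x ≡ ∑≤ g x) → ∀ x → f x ≡ g x
  ∑≤-injective {f} {g} eq = <-Ind.wfRec (λ x → f x ≡ g x) λ x ih →
    ∙-cancelˡ (AbelianGroup.group ℤ.+-0-abelianGroup) (∑< g x) (f x) (g x) (begin
      ∑< g x ℤ.+ f x  ≡⟨ cong (ℤ._+ f x) (∑-cong elements (below-eq x ih)) ⟨
      ∑< f x ℤ.+ f x  ≡⟨ ∑≤-split f x ⟨
      ∑≤ f x          ≡⟨ eq x ⟩
      ∑≤ g x          ≡⟨ ∑≤-split g x ⟩
      ∑< g x ℤ.+ g x  ∎)
    where
    open ≡-Reasoning
    below-eq : ∀ x → (∀ {z} → z < x → f z ≡ g z) →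
               ∀ z → f z when (z <? x) ≡ g z when (z <? x)
    below-eq x ih z with z <? x
    ... | yes z<x = ih z<x
    ... | no _    = refl

-- Möbius function and rank of a subposet

module SubposetProperties
  (P : FinPoset) {Q : Pred (Carrier P) 0ℓ} (Q? : Decidable Q)
  (b : Carrier P) (qb : Q b) (b-min : ∀ x → Q x → FinPoset._≤_ P b x) where

  open FinPoset P hiding (Carrier; Atom; rank; χ)
  open FinPosetProperties P

  S : FinPoset
  S = subposet P Q? b qb b-min

  private module S = FinPoset S

  member : (y : Carrier S) → Q (value y)
  member (x , [ q ]) = recompute (Q? x) q

  <-value⁺ : ∀ {y z} → y S.< z → value y < value z
  <-value⁺ (y≤z , y≢z) = y≤z , y≢z ∘ value-injective

  <-value⁻ : ∀ {y z} → value y < value z → y S.< z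
  <-value⁻ (y≤z , y≢z) = y≤z , y≢z ∘ cong value

  ∑-subposet : ∀ g → ∑ S.elements g ≡ ∑ elements (extend Q? g)
  ∑-subposet g = ∑-extend Q? (λ _ _ → refl) g elements

  ∑-when-extend : ∀ {R : Pred (Carrier P) 0ℓ} (R? : Decidable R) g →
                  ∑ elements (λ x → extend Q? g x when R? x) ≡
                  ∑ S.elements (λ y → g y when R? (value y))
  ∑-when-extend R? g = trans (∑-cong elements (extend-when Q? R? g))
                             (sym (∑-subposet _))

  -- Since `s` is the greatest element of `S` below `x`, the terms that survive are those below `s`
  -- in `S`, and `∑≤-μ` applies in `S`.
  ∑≤-extend-μ : ∀ {x} (s : Carrier S) → value s ≤ x →
                (∀ y → Q y → y ≤ x → y ≤ value s) →
                ∑≤ (extend Q? (S.μ S.0̂)) x ≡ 1ℤ when (b ≟ value s)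
  ∑≤-extend-μ {x} s s≤x s-max = begin
    ∑≤ (extend Q? (S.μ S.0̂)) x
      ≡⟨ ∑-when-extend (_≤? x) (S.μ S.0̂) ⟩
    ∑ S.elements (λ y → S.μ S.0̂ y when (value y ≤? x))
      ≡⟨ ∑-cong S.elements (λ y → when-⇔ (S.μ S.0̂ y) (value y ≤? x) (y S.≤? s)
           (s-max (value y) (member y)) (λ y≤s → ≤-trans y≤s s≤x)) ⟩
    FinPosetProperties.∑≤ S (S.μ S.0̂) s
      ≡⟨ FinPosetProperties.∑≤-μ S s ⟩
    1ℤ when (S.0̂ S.≟ s)
      ≡⟨ when-⇔ 1ℤ (S.0̂ S.≟ s) (b ≟ value s) (cong value) value-injective ⟩
    1ℤ when (b ≟ value s) ∎
    where open ≡-Reasoning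

  -- An element of S having a P-cocover in S has as long a chain in S as in P.
  rk-subposet : Ranked P → (∀ {x} → Q x → b ≢ x → ∃[ y ] Q y × y ⋖ x) →
                ∀ y → rk (value y) ≡ rk b ℕ.+ S.rk y
  rk-subposet ranked cocover-in = <S-Ind.wfRec _ step
    where
    module <S-Ind = WF.All S.<-wellFounded 0ℓ
    open FinPosetProperties S using ()
      renaming (rk-0̂ to rkS-0̂; rk-least to rkS-least; rk-mono to rkS-mono)
    open ℕ.≤-Reasoning

    step : ∀ y → (∀ {z} → z S.< y → rk (value z) ≡ rk b ℕ.+ S.rk z) →
           rk (value y) ≡ rk b ℕ.+ S.rk y
    step y ih with b ≟ value y
    ... | yes b≡y with refl ← value-injective {v = S.0̂} {w = y} b≡y =
      sym (trans (cong (rk b ℕ.+_) rkS-0̂) (ℕ.+-identityʳ (rk b)))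
    ... | no b≢y with z , qz , z⋖y ← cocover-in (member y) b≢y =
      ℕ.≤-antisym lower upper
      where
      z<y : (z , [ qz ]) S.< y
      z<y = <-value⁻ {z , [ qz ]} {y} (proj₁ z⋖y)

      lower : rk (value y) ℕ.≤ rk b ℕ.+ S.rk y
      lower = begin
        rk (value y)                      ≡⟨ ranked z⋖y ⟩
        suc (rk z)                        ≡⟨ cong suc (ih z<y) ⟩
        suc (rk b ℕ.+ S.rk (z , [ qz ]))  ≡⟨ ℕ.+-suc (rk b) _ ⟨
        rk b ℕ.+ suc (S.rk (z , [ qz ]))  ≤⟨ ℕ.+-monoʳ-≤ (rk b) (rkS-mono z<y) ⟩
        rk b ℕ.+ S.rk y                   ∎

      b≤rk : rk b ℕ.≤ rk (value y)
      b≤rk = ℕ.≤-trans (ℕ.n≤1+n _)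
                       (rk-mono (b-min (value y) (member y) , b≢y))

      -- `rkS-least` bounds `S.rk y` alone, so `rk b` is moved to the other side; `b≤rk` makes the
      -- truncated difference exact.
      upper : rk b ℕ.+ S.rk y ℕ.≤ rk (value y)
      upper = begin
        rk b ℕ.+ S.rk y
          ≤⟨ ℕ.+-monoʳ-≤ (rk b) (rkS-least {y} λ {w} w<y →
               ℕ.m+n≤o⇒m≤o∸n (suc (S.rk w)) (begin
                 suc (S.rk w) ℕ.+ rk b  ≡⟨ ℕ.+-comm _ (rk b) ⟩
                 rk b ℕ.+ suc (S.rk w)  ≡⟨ ℕ.+-suc (rk b) _ ⟩
                 suc (rk b ℕ.+ S.rk w)  ≡⟨ cong suc (ih w<y) ⟨
                 suc (rk (value w))     ≤⟨ rk-mono (<-value⁺ {w} {y} w<y) ⟩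
                 rk (value y)           ∎)) ⟩
        rk b ℕ.+ (rk (value y) ∸ rk b)
          ≡⟨ ℕ.m+[n∸m]≡n b≤rk ⟩
        rk (value y) ∎

-- Joins, atoms and generated subposets in a locally geometric poset

module LocalGeometry (P : FinPoset) (geo : LocallyGeometric P) where
  open FinPoset P hiding (Carrier; Atom; rank; χ)
  open FinPosetProperties P

  module _ {x : Carrier P} where
    open SubposetProperties P (_≤? x) 0̂ (minimum x) (λ y _ → minimum y)
    open FinPoset (below P x) using () renaming (_⋖_ to _⋖ₓ_)

    ⋖-below⁺ : ∀ {y z} → value y ⋖ value z → y ⋖ₓ z
    ⋖-below⁺ {y} {z} (y<z , none) = <-value⁻ {y} {z} y<z , λ (w , y<w , w<z) →
      none (value w , <-value⁺ {y} {w} y<w , <-value⁺ {w} {z} w<z)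

    -- `below P x` is downward closed, so an element of `P` strictly between `y` and `z` would
    -- already lie in it.
    ⋖-below⁻ : ∀ {y z} → y ⋖ₓ z → value y ⋖ value z
    ⋖-below⁻ {y} {z} (y<z , none) = <-value⁺ {y} {z} y<z , λ (w , y<w , w<z) →
      let v = w , [ ≤-trans (proj₁ w<z) (member z) ]
      in  none (v , <-value⁻ {y} {v} y<w , <-value⁻ {v} {z} w<z)

    member-≤ : (y : Carrier (below P x)) → value y ≤ x
    member-≤ = member

  module _ (x : Carrier P) where
    open IsGeometricLattice (geo x)
    open IsLattice isLattice
      using (x≤x∨y; y≤x∨y; ∨-least; x∧y≤x; x∧y≤y; ∧-greatest)

    -- The join is taken in the lattice below `x`, so `j` is least only among the upper bounds below
    -- `x`. The last component is one half of `geometric`.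
    join : ∀ {y b} → y ≤ x → b ≤ x →
           ∃[ j ] y ≤ j × b ≤ j × j ≤ x ×
                  (∀ {u} → u ≤ x → y ≤ u → b ≤ u → j ≤ u) ×
                  (Atom P b → ¬ b ≤ y → y ⋖ j)
    join {y} {b} y≤x b≤x =
      value j , x≤x∨y ŷ b̂ , y≤x∨y ŷ b̂ , member-≤ j ,
      (λ {u} u≤x → ∨-least {ŷ} {b̂} {u , [ u≤x ]}) ,
      λ atom b≰y → ⋖-below⁻ {y = ŷ} {j} (Equivalence.from (geometric ŷ j)
        (b̂ , ⋖-below⁺ {y = _ , [ minimum x ]} {b̂} atom , b≰y , refl))
      where
      ŷ b̂ j : Carrier (below P x)
      ŷ = y , [ y≤x ]
      b̂ = b , [ b≤x ]
      j = ŷ ∨ b̂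

    meet : ∀ {y z} → y ≤ x → z ≤ x →
           ∃[ m ] m ≤ y × m ≤ z × (∀ {u} → u ≤ x → u ≤ y → u ≤ z → u ≤ m)
    meet {y} {z} y≤x z≤x =
      value (ŷ ∧ ẑ) , x∧y≤x ŷ ẑ , x∧y≤y ŷ ẑ ,
      λ {u} u≤x → ∧-greatest {u , [ u≤x ]} {ŷ} {ẑ}
      where
      ŷ ẑ : Carrier (below P x)
      ŷ = y , [ y≤x ]
      ẑ = z , [ z≤x ]

    -- The other half of `geometric`; the last component expresses that `x` is the join of `y` and
    -- `c`.
    cover-atom : ∀ {y} → y ⋖ x →
                 ∃[ c ] Atom P c × c ≤ x × ¬ c ≤ y ×
                        (∀ {u} → y ≤ u → c ≤ u → u ≤ x → u ≡ x)
    cover-atom {y} y⋖x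
      with c , atom , c≰y , x≡y∨c ← Equivalence.to
             (geometric (y , [ proj₁ (proj₁ y⋖x) ]) (x , [ ≤-refl ]))
             (⋖-below⁺ {y = y , [ proj₁ (proj₁ y⋖x) ]} {x , [ ≤-refl ]} y⋖x)
      = value c , ⋖-below⁻ {y = _ , [ minimum x ]} {c} atom , member-≤ c , c≰y ,
        λ {u} y≤u c≤u u≤x → antisym u≤x
          (≤-trans (≤-reflexive (cong value x≡y∨c))
                   (∨-least {y , [ proj₁ (proj₁ y⋖x) ]} {c} {u , [ u≤x ]} y≤u c≤u))

  -- Write `x` as the join of a cocover `y` and an atom `c`. If `c` is `a`, then `y` is not `0̂`, as
  -- otherwise `x` would be `a`; an atom below `y` then differs from `a`, because `a` is not below
  -- `y`.
  another-atom : ∀ {a x} → Atom P a → 0̂ ≢ x → a ≢ x →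
                 ∃[ b ] Atom P b × b ≢ a × b ≤ x
  another-atom {a} {x} atom-a 0≢x a≢x
    with y , _ , y⋖x ← cocover (minimum x , 0≢x)
    with c , atom-c , c≤x , c≰y , join-x ← cover-atom x y⋖x
    with c ≟ a | 0̂ ≟ y
  ... | no c≢a   | _        = c , atom-c , c≢a , c≤x
  ... | yes refl | yes refl = ⊥-elim (a≢x (join-x (minimum c) ≤-refl c≤x))
  ... | yes refl | no 0≢y
    with z , _ , z⋖y ← cocover (minimum y , 0≢y)
    with b , atom-b , b≤y , _ ← cover-atom y z⋖y
    = b , atom-b , (λ { refl → c≰y b≤y }) , ≤-trans b≤y (proj₁ (proj₁ y⋖x))

  module _ {B : List (Carrier P)} where

    -- In a lattice, a minimal upper bound is the least one.
    generated-least : ∀ {x y} → y ≤ x → Generated P B y →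
                      ∃[ T ] T ⊆ B × UpperBound T y ×
                             (∀ {u} → u ≤ x → UpperBound T u → y ≤ u)
    -- `0̂` counts as the least upper bound of the empty set.
    generated-least y≤x (inj₁ refl) = [] , (λ ()) , [] , λ _ _ → minimum _
    generated-least {x} y≤x (inj₂ (T , _ , T⊆B , T≤y , least)) =
      T , T⊆B , T≤y , λ u≤x T≤u →
        -- The meet of `y` and `u` still bounds `T`, so minimality of `y` forces it to be `y`.
        let m , m≤y , m≤u , m-greatest = meet x y≤x u≤x
            T≤m = All.zipWith (λ (t≤y , t≤u) → m-greatest (≤-trans t≤y y≤x) t≤y t≤u)
                              (T≤y , T≤u)
        in  subst (_≤ _) (least m T≤m m≤y) m≤u

    generated-≤ : ∀ {x y z} → y ≤ x → z ≤ x → Generated P B y →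
                  (∀ {b} → b ∈ B → b ≤ x → b ≤ z) → y ≤ z
    generated-≤ y≤x z≤x gen B≤z with T , T⊆B , T≤y , least ← generated-least y≤x gen =
      least z≤x (All.tabulate λ t∈T →
        B≤z (T⊆B t∈T) (≤-trans (All.lookup T≤y t∈T) y≤x))

    -- Adding `b` to a set generating `y` generates the join. It is minimal in all of `P`, since any
    -- competitor below `j` is also below `x`.
    generated-join : ∀ {x y b} → y ≤ x → b ≤ x → b ∈ B → Generated P B y →
                     ∃[ j ] Generated P B j × y ≤ j × b ≤ j × j ≤ x ×
                            (Atom P b → ¬ b ≤ y → y ⋖ j)
    generated-join {x} {y} {b} y≤x b≤x b∈B gen
      with T , T⊆B , T≤y , least ← generated-least y≤x gen
      with j , y≤j , b≤j , j≤x , j-least , covers ← join x y≤x b≤x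
      = j , inj₂ (b ∷ T , (λ ()) , b∷T⊆B , b≤j ∷ All.map (λ t≤y → ≤-trans t≤y y≤j) T≤y ,
                  λ { u (b≤u ∷ T≤u) u≤j → let u≤x = ≤-trans u≤j j≤x in
                      antisym u≤j (j-least u≤x (least u≤x T≤u) b≤u) }) ,
        y≤j , b≤j , j≤x , covers
      where
      b∷T⊆B : (b ∷ T) ⊆ B
      b∷T⊆B (here refl)  = b∈B
      b∷T⊆B (there t∈T) = T⊆B t∈T

    -- Let `m` be maximal in P(B) below `x`. Joining `m` with any `b` of `B` below `x` stays in P(B)
    -- and below `x`, so `b` is below `m`; this makes `m` the greatest such element.
    generated-floor : ∀ x → ∃[ m ] Generated P B m × m ≤ x ×
                      (∀ {b} → b ∈ B → b ≤ x → b ≤ m) ×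
                      (∀ y → Generated P B y → y ≤ x → y ≤ m)
    generated-floor x
      with m , (gen , m≤x) , _ , max ←
             maximal (λ z → generated? P B z ×-dec z ≤? x) (inj₁ refl , minimum x)
      = m , gen , m≤x , B≤m , λ y gen-y y≤x → generated-≤ y≤x m≤x gen-y B≤m
      where
      B≤m : ∀ {b} → b ∈ B → b ≤ x → b ≤ m
      B≤m b∈B b≤x with j , gen-j , m≤j , b≤j , j≤x , _ ← generated-join m≤x b≤x b∈B gen =
        subst (_ ≤_) (max (gen-j , j≤x) m≤j) b≤j

    -- Let `m` be maximal in P(B) strictly below `x`. Some generator `b` of `x` is not below `m`;
    -- the join of `m` and `b` is then `x` by maximality, and it covers `m` because `b` is an atom.
    generated-cocover : (∀ {b} → b ∈ B → Atom P b) → ∀ {x} → Generated P B x →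
                        0̂ ≢ x → ∃[ y ] Generated P B y × y ⋖ x
    generated-cocover atomic {x} gen 0≢x
      with m , (gen-m , m<x) , _ , max ←
             maximal (λ z → generated? P B z ×-dec z <? x)
                     (inj₁ refl , minimum x , 0≢x)
      with T , T⊆B , T≤x , least ← generated-least ≤-refl gen
      with All.all? (_≤? m) T
    ... | yes T≤m = ⊥-elim (<-irrefl m<x (least (proj₁ m<x) T≤m))
    ... | no T≰m
      with b , b∈T , b≰m ← find (All.¬All⇒Any¬ (_≤? m) T T≰m)
      with j , gen-j , m≤j , b≤j , j≤x , covers ←
             generated-join (proj₁ m<x) (All.lookup T≤x b∈T) (T⊆B b∈T) gen-m
      with j ≟ x
    ... | yes refl = m , gen-m , covers (atomic (T⊆B b∈T)) b≰m
    ... | no j≢x   = ⊥-elim (b≰m (subst (b ≤_) (max (gen-j , j≤x , j≢x) m≤j) b≤j))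

-- Möbius functions and ranks of the deletion and the contraction

module DeletionContraction
  (P : FinPoset) (ranked : Ranked P) (geo : LocallyGeometric P)
  (a : Carrier P) (atom-a : Atom P a) where

  open FinPoset P hiding (Carrier; Atom; rank; χ)
  open FinPosetProperties P
  open LocalGeometry P geo

  P′ P″ : FinPoset
  P′ = deletion P a
  P″ = contraction P a

  private
    module P′ = FinPoset P′
    module P″ = FinPoset P″

    A∖a : List (Carrier P)
    A∖a = filter (λ b → ¬? (b ≟ a)) atoms

    ∈A∖a⁺ : ∀ {b} → Atom P b → b ≢ a → b ∈ A∖a
    ∈A∖a⁺ atom-b b≢a =
      ∈-filter⁺ (λ b → ¬? (b ≟ a)) (∈-filter⁺ atom? (complete _) atom-b) b≢a

    ∈A∖a⁻ : ∀ {b} → b ∈ A∖a → Atom P b × b ≢ a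
    ∈A∖a⁻ b∈B with b∈atoms , b≢a ← ∈-filter⁻ (λ b → ¬? (b ≟ a)) {xs = atoms} b∈B =
      proj₂ (∈-filter⁻ atom? {xs = elements} b∈atoms) , b≢a

  module Del = SubposetProperties P (generated? P A∖a) 0̂ (inj₁ refl)
                                  (λ x _ → minimum x)
  module Con = SubposetProperties P (a ≤?_) a ≤-refl (λ _ a≤x → a≤x)

  μ′ μ″ : Carrier P → ℤ
  μ′ = extend (generated? P A∖a) (P′.μ P′.0̂)
  μ″ = extend (a ≤?_) (P″.μ P″.0̂)

  -- Here `m` is the greatest element of the deletion below `x`. For `x = a` no generator lies below
  -- `x`; for `x` other than `0̂` and `a`, the atom from `another-atom` lies below `m`.
  floor-0̂ : ∀ {x m} → Generated P A∖a m → m ≤ x → (∀ {b} → b ∈ A∖a → b ≤ x → b ≤ m) →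
            1ℤ when (0̂ ≟ m) ≡ (1ℤ when (0̂ ≟ x)) ℤ.+ (1ℤ when (a ≟ x))
  floor-0̂ {x} {m} gen m≤x A∖a≤m = cases (0̂ ≟ x) (a ≟ x)
    where
    cases : (d : Dec (0̂ ≡ x)) (e : Dec (a ≡ x)) →
            1ℤ when (0̂ ≟ m) ≡ (1ℤ when d) ℤ.+ (1ℤ when e)
    cases (yes refl) (yes refl) = ⊥-elim (proj₂ (proj₁ atom-a) refl)
    cases (yes refl) (no _) = when-yes 1ℤ (0̂ ≟ m) (antisym (minimum m) m≤x)
    cases (no _) (yes refl) = when-yes 1ℤ (0̂ ≟ m) (antisym (minimum m)
      (generated-≤ m≤x (minimum a) gen λ b∈B b≤a →
        let atom-b , b≢a = ∈A∖a⁻ b∈B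
        in  ⊥-elim (not-below atom-b b≢a (≤-atom atom-a b≤a))))
      where
      not-below : ∀ {b} → Atom P b → b ≢ a → ¬ (b ≡ 0̂ ⊎ b ≡ a)
      not-below ((_ , 0≢b) , _) b≢a (inj₁ b≡0) = 0≢b (sym b≡0)
      not-below _               b≢a (inj₂ b≡a) = b≢a b≡a
    cases (no 0≢x) (no a≢x) = when-no 1ℤ (0̂ ≟ m) λ { refl →
      let b , atom-b , b≢a , b≤x = another-atom atom-a 0≢x a≢x
      in  <-irrefl (proj₁ atom-b) (A∖a≤m (∈A∖a⁺ atom-b b≢a) b≤x) }

  ∑≤-μ′ : ∀ x → ∑≤ μ′ x ≡ (1ℤ when (0̂ ≟ x)) ℤ.+ (1ℤ when (a ≟ x))
  ∑≤-μ′ x =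
    let m , gen , m≤x , A∖a≤m , greatest = generated-floor x
    in  trans (Del.∑≤-extend-μ (m , [ gen ]) m≤x greatest) (floor-0̂ gen m≤x A∖a≤m)

  -- If `a` is below `x`, then `x` is itself the greatest element of the contraction below `x`;
  -- otherwise the sum has no nonzero term.
  ∑≤-μ″ : ∀ x → ∑≤ μ″ x ≡ 1ℤ when (a ≟ x)
  ∑≤-μ″ x with a ≤? x
  ... | yes a≤x = Con.∑≤-extend-μ (x , [ a≤x ]) ≤-refl (λ _ _ y≤x → y≤x)
  ... | no a≰x  = trans
    (trans (Con.∑-when-extend (_≤? x) (P″.μ P″.0̂))
           (∑-zero P″.elements λ y → when-no (P″.μ P″.0̂ y) (value y ≤? x) λ y≤x →
             a≰x (≤-trans (Con.member y) y≤x)))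
    (sym (when-no 1ℤ (a ≟ x) (a≰x ∘ ≤-reflexive)))

  μ-deletion-contraction : ∀ x → μ 0̂ x ≡ μ′ x ℤ.- μ″ x
  μ-deletion-contraction = ∑≤-injective λ x → begin
    ∑≤ (μ 0̂) x
      ≡⟨ ∑≤-μ x ⟩
    (1ℤ when (0̂ ≟ x))
      ≡⟨ ℤ.+-identityʳ _ ⟨
    (1ℤ when (0̂ ≟ x)) ℤ.+ 0ℤ
      -- The indicator of `a` is added and subtracted: it occurs in the sums of both `μ′` and `μ″`.
      ≡⟨ cong (λ z → (1ℤ when (0̂ ≟ x)) ℤ.+ z) (ℤ.+-inverseʳ (1ℤ when (a ≟ x))) ⟨
    (1ℤ when (0̂ ≟ x)) ℤ.+ ((1ℤ when (a ≟ x)) ℤ.- (1ℤ when (a ≟ x)))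
      ≡⟨ ℤ.+-assoc (1ℤ when (0̂ ≟ x)) (1ℤ when (a ≟ x)) _ ⟨
    (1ℤ when (0̂ ≟ x)) ℤ.+ (1ℤ when (a ≟ x)) ℤ.- (1ℤ when (a ≟ x))
      ≡⟨ cong₂ ℤ._-_ (∑≤-μ′ x) (∑≤-μ″ x) ⟨
    ∑≤ μ′ x ℤ.- ∑≤ μ″ x
      ≡⟨ ∑-when-minus (_≤? x) elements μ′ μ″ ⟨
    ∑≤ (λ z → μ′ z ℤ.- μ″ z) x ∎
    where open ≡-Reasoning

  rk-deletion : ∀ y → rk (value y) ≡ P′.rk y
  rk-deletion y = trans
    (Del.rk-subposet ranked (generated-cocover (proj₁ ∘ ∈A∖a⁻)) y)
    (cong (ℕ._+ P′.rk y) rk-0̂)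

  -- Cocovers can be chosen above `a`, and the offset is the rank of `a`, which is one.
  rk-contraction : ∀ y → rk (value y) ≡ suc (P″.rk y)
  rk-contraction y = trans
    (Con.rk-subposet ranked (λ a≤x a≢x → cocover (a≤x , a≢x)) y)
    (cong (ℕ._+ P″.rk y) (trans (ranked atom-a) (cong suc rk-0̂)))

  -- Makes the truncated difference of the two ranks a true one, as `exponent-deletion` requires.
  rank-deletion : rank P′ ℕ.≤ rank P
  rank-deletion = FinPosetProperties.rank-least P′ λ y →
    subst (ℕ._≤ rank P) (rk-deletion y) (rk≤rank (value y))

  exponent-deletion : ∀ y →
                      (rank P ∸ rank P′) ℕ.+ (rank P′ ∸ P′.rk y) ≡ rank P ∸ rk (value y)
  exponent-deletion y = begin
    (rank P ∸ rank P′) ℕ.+ (rank P′ ∸ P′.rk y)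
      ≡⟨ ℕ.+-∸-assoc (rank P ∸ rank P′) (FinPosetProperties.rk≤rank P′ y) ⟨
    (rank P ∸ rank P′) ℕ.+ rank P′ ∸ P′.rk y
      ≡⟨ cong₂ _∸_ (ℕ.m∸n+n≡m rank-deletion) (sym (rk-deletion y)) ⟩
    rank P ∸ rk (value y) ∎
    where open ≡-Reasoning

-- Comparison of the characteristic polynomials by coefficients

theorem3p5 :
  (P : FinPoset) → Ranked P → LocallyGeometric P →
  (a : Carrier P) → Atom P a →
  rank P ≡ suc (rank (contraction P a)) →
  χ P ≈ t^ (rank P ∸ rank (deletion P a)) · χ (deletion P a) - χ (contraction P a)
theorem3p5 P ranked geo a atom-a rank-P k = begin
  coeff (χ P) k
    ≡⟨ coeff-shifted-∑ 0 elements (λ x → rank P ∸ rk x) (μ 0̂) k ⟩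
  ∑ elements (λ x → μ 0̂ x when K? x)
    ≡⟨ ∑-cong elements (λ x → cong (_when K? x) (μ-deletion-contraction x)) ⟩
  ∑ elements (λ x → (μ′ x ℤ.- μ″ x) when K? x)
    ≡⟨ ∑-when-minus K? elements μ′ μ″ ⟩
  ∑ elements (λ x → μ′ x when K? x) ℤ.- ∑ elements (λ x → μ″ x when K? x)
    ≡⟨ cong₂ ℤ._-_ deleted contracted ⟨
  coeff (t^ ε · χ P′) k ℤ.- coeff (χ P″) k
    ≡⟨ coeff-- (t^ ε · χ P′) (χ P″) k ⟨
  coeff (t^ ε · χ P′ - χ P″) k ∎
  where
  open ≡-Reasoning
  open FinPoset P using (elements; rk; μ; 0̂)
  open DeletionContraction P ranked geo a atom-a
  module P′ = FinPoset P′
  module P″ = FinPoset P″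

  ε : ℕ
  ε = rank P ∸ rank P′

  -- Selects the elements that contribute to degree `k` in `χ P`; the other two polynomials are
  -- reduced to the same selection.
  K? : Decidable (λ x → rank P ∸ rk x ≡ k)
  K? x = rank P ∸ rk x ℕ.≟ k

  deleted : coeff (t^ ε · χ P′) k ≡ ∑ elements (λ x → μ′ x when K? x)
  deleted = begin
    coeff (t^ ε · χ P′) k
      ≡⟨ coeff-shifted-∑ ε P′.elements (λ y → rank P′ ∸ P′.rk y) (P′.μ P′.0̂) k ⟩
    ∑ P′.elements (λ y → P′.μ P′.0̂ y when (ε ℕ.+ (rank P′ ∸ P′.rk y) ℕ.≟ k))
      ≡⟨ ∑-cong P′.elements (λ y → cong (λ n → P′.μ P′.0̂ y when (n ℕ.≟ k))
                                        (exponent-deletion y)) ⟩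
    ∑ P′.elements (λ y → P′.μ P′.0̂ y when K? (value y))
      ≡⟨ Del.∑-when-extend K? (P′.μ P′.0̂) ⟨
    ∑ elements (λ x → μ′ x when K? x) ∎

  contracted : coeff (χ P″) k ≡ ∑ elements (λ x → μ″ x when K? x)
  contracted = begin
    coeff (χ P″) k
      ≡⟨ coeff-shifted-∑ 0 P″.elements (λ y → rank P″ ∸ P″.rk y) (P″.μ P″.0̂) k ⟩
    ∑ P″.elements (λ y → P″.μ P″.0̂ y when (rank P″ ∸ P″.rk y ℕ.≟ k))
      -- By `rank-P` and `rk-contraction` both the total rank and the rank of `y` drop by one, so
      -- the exponent is unchanged.
      ≡⟨ ∑-cong P″.elements (λ y → cong (λ n → P″.μ P″.0̂ y when (n ℕ.≟ k))
           (sym (cong₂ _∸_ rank-P (rk-contraction y)))) ⟩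
    ∑ P″.elements (λ y → P″.μ P″.0̂ y when K? (value y))
      ≡⟨ Con.∑-when-extend K? (P″.μ P″.0̂) ⟨
    ∑ elements (λ x → μ″ x when K? x) ∎
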